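{- Let $\mathcal A$ be a class of function algebras. Then $\mathcal A\mathsf{RA}_2$ is a lifted extension of $\mathcal A\mathsf{RA}_1$; that is, for every sentence $\varphi$ of $L_1(X,\vec f)$ such that $\mathcal A\mathsf{RA}_1\vdash\varphi$ we have $\mathcal A\mathsf{RA}_2\vdash\varphi{\uparrow}$.
   Context: **Language $L_1$ and BASIC.** $L_1$ is the first-order language with constant $0$, unary function symbols $S,H,T$, binary function symbols $+,\cdot$, a binary pairing function symbol $(\cdot,\cdot)$, and a binary relation $<$. Write $1=S(0)$, $2=S(S(0))$, and $x\le y$ for $x<y\lor x=y$. Pairing associates to the right, and $f(x,y)$ means $f((x,y))$. BASIC consists of the universal closures of: $S(x)\neq 0$; $S(x)=S(y)\to x=y$; $x+0=x$; $x+S(y)=S(x+y)$; $x\cdot 0=0$; $x\cdot S(y)=x\cdot y+x$; $\lnot x<0$; $x<S(y)\leftrightarrow x<y\lor x=y$; $x<y\lor x=y\lor y<x$; $0<x\to\exists y<x\,S(y)=x$; $(x,y)=z\leftrightarrow 2\cdot z=(x+y)\cdot(x+y+1)+2\cdot x+2$; $(x,y)=(x',y')\to x=x'\land y=y'$; $z>0\to\exists x,y<z\,(x,y)=z$; $H((x,y))=x$; $H(0)=0$; $T((x,y))=y$; $T(0)=0$. **$L_2$ and functions as sets.** $L_2$ is the two-sorted language extending $L_1$ with set variables and atomic formulas $t\in X$. $L_1(X,\vec f)$ is $L_1$ with additional unary predicate symbols ("set constants") $X$ and $f_d$ ($d$ a derivation, below). For a set $f$, $f\in\mathcal F$ abbreviates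 $\forall x\exists y\,(x,y)\in f\land\forall x,y,y'((x,y)\in f\land(x,y')\in f\to y=y')\land 0\notin f$; $f(t)=s$ abbreviates $(t,s)\in f$. **Function operators and classes of algebras.** A function operator $f:=\mathrm{op}(g_1,\dots,g_n)$ ($n\ge 0$) is specified by a formula of $L_2$ with no free number variables and no set quantifiers, containing exactly the set variables $f,g_1,\dots,g_n$, such that for all $X\subseteq\mathbb N$ and $g_1,\dots,g_n\subseteq\mathbb N$ in $\mathcal F$ there is a unique $f\subseteq\mathbb N$ satisfying $f:=\mathrm{op}(g_1,\dots,g_n)$ and $f\in\mathcal F$. The oracle operator $f:=X_\ast$ is $\forall x((x\in X\to f(x)=1)\land(x\notin X\to f(x)=0))$. A class of function algebras $\mathcal A$ is given by a finite tuple of function operators; it is required throughout that this tuple contains the following operators, each the universal closure of the displayed formula: - $f:=\mathrm S$: $f(x)=S(x)$; - $f:=\oplus$: $f(x,y)=x+y\land f(0)=0$; - $f:=\otimes$: $f(x,y)=x\cdot y\land f(0)=0$; - $f:={<_\ast}$: $(x<y\to f(x,y)=1)\land(x\ge y\to f(x,y)=0)\land f(0)=0$; - $f:=\mathrm I$: $f(x)=x$; - $f:=\mathrm D$: $f(0,y,z)=y\land f(S(x),y,z)=z\land f(0)=0\land f(x,0)=0$; - $f:=\mathrm P(g,h)$: $g(x)=v\land h(x)=w\to f(x)=(v,w)$; - $f:=g\circ h$: $h(x)=z\land g(z)=y\to f(x)=y$; - $f:=\mu(g)$: $(f(b,x)=z\to z\le b)\land(f(b,x)=z\land y<b\land g(y,x)=1\to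 z\le y)\land(f(b,x)=z\land z<b\to g(z,x)=1)\land f(0)=0$. **Derivations and $\mathcal A\mathsf{RA}_1$.** Derivations in $\mathcal A$ are the least set of formal terms containing the symbol $X_\ast$ and containing $\mathrm{op}(d_1,\dots,d_n)$ for each $n$-ary operator $\mathrm{op}$ of $\mathcal A$ and derivations $d_1,\dots,d_n$. They are enumerated in a fixed sequence in which $\mathrm{op}(d_1,\dots,d_n)$ is preceded by $d_1,\dots,d_n$, and are identified with their indices in $\mathbb N$; so $\vec f=f_0,f_1,\dots$. $\mathcal A\mathsf{RA}_1$ is the theory in $L_1(X,\vec f)$ consisting of BASIC, the axioms $f_{X_\ast}:=X_\ast$ and $f_{X_\ast}\in\mathcal F$, and for each operator and derivations $d_1,\dots,d_n$ the axioms $f_{\mathrm{op}(d_1,\dots,d_n)}:=\mathrm{op}(f_{d_1},\dots,f_{d_n})$ and $f_{\mathrm{op}(d_1,\dots,d_n)}\in\mathcal F$. **$\mathcal A\mathsf{RA}_2$.** The $L_2$-theory axiomatized by BASIC; for each operator $\mathrm{op}$ of $\mathcal A$, $\forall g_1,\dots,g_n\in\mathcal F\,\exists f\in\mathcal F\;f:=\mathrm{op}(g_1,\dots,g_n)$; the oracle axiom $\forall X\exists f\in\mathcal F\;f:=X_\ast$; and function comprehension $\forall p\,\forall f\in\mathcal F\,\exists X\,\forall x(x\in X\leftrightarrow f(x,p)=1)$. **Lifting.** For $k\in\mathbb N$ let $\Phi_k$ be the set of axioms of $\mathcal A\mathsf{RA}_1$ defining the constants $f_0,\dots,f_{k-1}$,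 i.e. for each $d<k$ the oracle axiom or operator axiom for $f_d$, together with $f_d\in\mathcal F$. For a sentence $\varphi$ of $L_1(X,\vec f)$ let $k=d+1$ for the largest $d$ such that $f_d$ occurs in $\varphi$, and $k=0$ if there is none. Treating the set constants $X,f_0,\dots,f_{k-1}$ as set variables, the lifted form $\varphi{\uparrow}$ is the $L_2$-sentence $\forall X\,\forall f_0\cdots\forall f_{k-1}\bigl(\bigwedge\Phi_k\to\varphi\bigr)$. -}

module Defs where

open import Data.Empty using (⊥)
open import Data.Fin using (Fin; zero; suc; fromℕ<)
open import Data.List using (List; []; _∷_; map; foldr; tabulate)
open import Data.List.Membership.Propositional using () renaming (_∈_ to _∈ˡ_)
open import Data.List.Relation.Unary.All using (All)
open import Data.Nat using (ℕ; zero; suc; _+_; _*_; _∸_; _<_; _⊔_; s≤s; ⌊_/2⌋)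
open import Data.Nat.Properties using (m∸n≤m)
open import Data.Product using (Σ; ∃; _×_; _,_; proj₁; proj₂)
open import Data.Sum using (_⊎_)
open import Data.Vec using (Vec; lookup)
open import Data.Vec.Functional using () renaming ([] to []ᵛ; _∷_ to _∷ᵛ_)
open import Function using (_⇔_)
open import Function.Bundles using (_↔_; Inverse)
open import Relation.Binary.PropositionalEquality using (_≡_)
open import Relation.Nullary using (¬_)

------------------------------------------------------------------------
-- Syntax

infix  9 _⦅_⦆≐_
infixl 8 _·̇_
infixl 7 _+̇_
infix  6 _≐_ _<̇_ _≤̇_ _∈̇_
infixr 5 _∧̇_
infixr 4 _∨̇_
infixr 3 _⇒_
infix  2 _⇔̇_

data Term (n : ℕ) : Set where
  var       : Fin n → Term n
  0̇         : Term n
  Ṡ Ḣ Ṫ     : Term n → Term n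
  _+̇_ _·̇_   : Term n → Term n → Term n
  ⟨_,_⟩     : Term n → Term n → Term n

-- C is the set of set constants of the language, m the number of free set
-- variables (there are no other set terms).
data SetTerm (C : Set) (m : ℕ) : Set where
  const : C → SetTerm C m
  var   : Fin m → SetTerm C m

data Order : Set where
  first second : Order

-- Formulas with set constants from C, m free set variables and n free number
-- variables (de Bruijn indices, one name space per sort).  Formulas of order
-- `first` are those without set quantifiers.  Equality is a relation between
-- numbers only.  The language L₁ with set constants C is Formula C first 0, and
-- L₂ is Formula ⊥ second.
data Formula (C : Set) : Order → (m n : ℕ) → Set where
  _≐_ _<̇_       : ∀ {o m n} → Term n → Term n → Formula C o m n
  _∈̇_           : ∀ {o m n} → Term n → SetTerm C m → Formula C o m n
  ⊥̇             : ∀ {o m n} → Formula C o m n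
  _⇒_ _∧̇_ _∨̇_   : ∀ {o m n} → Formula C o m n → Formula C o m n → Formula C o m n
  ∀̇ ∃̇           : ∀ {o m n} → Formula C o m (suc n) → Formula C o m n
  ∀² ∃²         : ∀ {m n} → Formula C second (suc m) n → Formula C second m n

private variable
  C C′     : Set
  o        : Order
  m m′ n n′ : ℕ

⊤̇ : Formula C o m n
⊤̇ = ⊥̇ ⇒ ⊥̇

¬̇_ : Formula C o m n → Formula C o m n
¬̇ φ = φ ⇒ ⊥̇

_⇔̇_ : Formula C o m n → Formula C o m n → Formula C o m n
φ ⇔̇ ψ = (φ ⇒ ψ) ∧̇ (ψ ⇒ φ)

⋀ : List (Formula C o m n) → Formula C o m n
⋀ = foldr _∧̇_ ⊤̇

1̇ 2̇ : Term n
1̇ = Ṡ 0̇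
2̇ = Ṡ 1̇

_≤̇_ : Term n → Term n → Formula C o m n
s ≤̇ t = s <̇ t ∨̇ s ≐ t

_⦅_⦆≐_ : SetTerm C m → Term n → Term n → Formula C o m n
f ⦅ t ⦆≐ s = ⟨ t , s ⟩ ∈̇ f

-- xᵢ is the number variable with de Bruijn index i.
x₀ : Term (1 + n)
x₀ = var zero
x₁ : Term (2 + n)
x₁ = var (suc zero)
x₂ : Term (3 + n)
x₂ = var (suc (suc zero))
x₃ : Term (4 + n)
x₃ = var (suc (suc (suc zero)))

X₀ : SetTerm C (1 + m)
X₀ = var zero
X₁ : SetTerm C (2 + m)
X₁ = var (suc zero)
X₂ : SetTerm C (3 + m)
X₂ = var (suc (suc zero))

closure : ∀ n → Formula C o m n → Formula C o m 0
closure zero    φ = φ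
closure (suc n) φ = closure n (∀̇ φ)

closure² : ∀ m → Formula C second m n → Formula C second 0 n
closure² zero    φ = φ
closure² (suc m) φ = closure² m (∀² φ)

------------------------------------------------------------------------
-- Substitution

renameTerm : (Fin n → Fin n′) → Term n → Term n′
renameTerm ρ (var i)     = var (ρ i)
renameTerm ρ 0̇           = 0̇
renameTerm ρ (Ṡ t)       = Ṡ (renameTerm ρ t)
renameTerm ρ (Ḣ t)       = Ḣ (renameTerm ρ t)
renameTerm ρ (Ṫ t)       = Ṫ (renameTerm ρ t)
renameTerm ρ (s +̇ t)     = renameTerm ρ s +̇ renameTerm ρ t
renameTerm ρ (s ·̇ t)     = renameTerm ρ s ·̇ renameTerm ρ t
renameTerm ρ ⟨ s , t ⟩   = ⟨ renameTerm ρ s , renameTerm ρ t ⟩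

substTerm : (Fin n → Term n′) → Term n → Term n′
substTerm σ (var i)     = σ i
substTerm σ 0̇           = 0̇
substTerm σ (Ṡ t)       = Ṡ (substTerm σ t)
substTerm σ (Ḣ t)       = Ḣ (substTerm σ t)
substTerm σ (Ṫ t)       = Ṫ (substTerm σ t)
substTerm σ (s +̇ t)     = substTerm σ s +̇ substTerm σ t
substTerm σ (s ·̇ t)     = substTerm σ s ·̇ substTerm σ t
substTerm σ ⟨ s , t ⟩   = ⟨ substTerm σ s , substTerm σ t ⟩

under : (Fin n → Term n′) → Fin (suc n) → Term (suc n′)
under σ zero    = var zero
under σ (suc i) = renameTerm suc (σ i)

subst : (Fin n → Term n′) → Formula C o m n → Formula C o m n′
subst σ (s ≐ t)  = substTerm σ s ≐ substTerm σ t
subst σ (s <̇ t)  = substTerm σ s <̇ substTerm σ t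
subst σ (t ∈̇ X)  = substTerm σ t ∈̇ X
subst σ ⊥̇        = ⊥̇
subst σ (φ ⇒ ψ)  = subst σ φ ⇒ subst σ ψ
subst σ (φ ∧̇ ψ)  = subst σ φ ∧̇ subst σ ψ
subst σ (φ ∨̇ ψ)  = subst σ φ ∨̇ subst σ ψ
subst σ (∀̇ φ)    = ∀̇ (subst (under σ) φ)
subst σ (∃̇ φ)    = ∃̇ (subst (under σ) φ)
subst σ (∀² φ)   = ∀² (subst σ φ)
subst σ (∃² φ)   = ∃² (subst σ φ)

weaken : Formula C o m n → Formula C o m (suc n)
weaken = subst (λ i → var (suc i))

instantiate : Term n → Fin (suc n) → Term n
instantiate t zero    = t
instantiate t (suc i) = var i

_[_] : Formula C o m (suc n) → Term n → Formula C o m n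
φ [ t ] = subst (instantiate t) φ

weakenSetTerm : SetTerm C m → SetTerm C (suc m)
weakenSetTerm (const c) = const c
weakenSetTerm (var i)   = var (suc i)

under² : (SetTerm C m → SetTerm C′ m′) → SetTerm C (suc m) → SetTerm C′ (suc m′)
under² τ (const c)     = weakenSetTerm (τ (const c))
under² τ (var zero)    = var zero
under² τ (var (suc i)) = weakenSetTerm (τ (var i))

-- Simultaneous replacement of set constants and set variables.
subst² : (SetTerm C m → SetTerm C′ m′) → Formula C o m n → Formula C′ o m′ n
subst² τ (s ≐ t)  = s ≐ t
subst² τ (s <̇ t)  = s <̇ t
subst² τ (t ∈̇ X)  = t ∈̇ τ X
subst² τ ⊥̇        = ⊥̇
subst² τ (φ ⇒ ψ)  = subst² τ φ ⇒ subst² τ ψ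
subst² τ (φ ∧̇ ψ)  = subst² τ φ ∧̇ subst² τ ψ
subst² τ (φ ∨̇ ψ)  = subst² τ φ ∨̇ subst² τ ψ
subst² τ (∀̇ φ)    = ∀̇ (subst² τ φ)
subst² τ (∃̇ φ)    = ∃̇ (subst² τ φ)
subst² τ (∀² φ)   = ∀² (subst² (under² τ) φ)
subst² τ (∃² φ)   = ∃² (subst² (under² τ) φ)

weaken² : Formula C o m n → Formula C o (suc m) n
weaken² = subst² weakenSetTerm

instantiate² : SetTerm C m → SetTerm C (suc m) → SetTerm C m
instantiate² X (const c)     = const c
instantiate² X (var zero)    = X
instantiate² X (var (suc i)) = var i

_[_]² : Formula C o (suc m) n → SetTerm C m → Formula C o m n
φ [ X ]² = subst² (instantiate² X) φ

embed : Formula C first m n → Formula C o m n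
embed (s ≐ t)  = s ≐ t
embed (s <̇ t)  = s <̇ t
embed (t ∈̇ X)  = t ∈̇ X
embed ⊥̇        = ⊥̇
embed (φ ⇒ ψ)  = embed φ ⇒ embed ψ
embed (φ ∧̇ ψ)  = embed φ ∧̇ embed ψ
embed (φ ∨̇ ψ)  = embed φ ∨̇ embed ψ
embed (∀̇ φ)    = ∀̇ (embed φ)
embed (∃̇ φ)    = ∃̇ (embed φ)

-- Occurrence of a set term in a formula without set quantifiers.
Occurs : SetTerm C m → Formula C first m n → Set
Occurs X (s ≐ t)  = ⊥
Occurs X (s <̇ t)  = ⊥
Occurs X (t ∈̇ Y)  = X ≡ Y
Occurs X ⊥̇        = ⊥
Occurs X (φ ⇒ ψ)  = Occurs X φ ⊎ Occurs X ψ
Occurs X (φ ∧̇ ψ)  = Occurs X φ ⊎ Occurs X ψ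
Occurs X (φ ∨̇ ψ)  = Occurs X φ ⊎ Occurs X ψ
Occurs X (∀̇ φ)    = Occurs X φ
Occurs X (∃̇ φ)    = Occurs X φ

------------------------------------------------------------------------
-- Provability: classical natural deduction with equality

infix 1 _⊢_ _⊩_

-- With o = first this is one-sorted first-order logic (no rule can introduce
-- a set quantifier); with o = second it is two-sorted first-order logic.
-- That the set sort is non-empty is not built into the rules; ARA₂ below proves
-- it, having nullary operators among its axioms.
data _⊢_ {C : Set} : ∀ {o m n} → List (Formula C o m n) → Formula C o m n → Set where
  hyp   : ∀ {o m n} {Γ : List (Formula C o m n)} {φ} → φ ∈ˡ Γ → Γ ⊢ φ
  raa   : ∀ {o m n} {Γ : List (Formula C o m n)} {φ} → (¬̇ φ) ∷ Γ ⊢ ⊥̇ → Γ ⊢ φ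
  ⇒I    : ∀ {o m n} {Γ : List (Formula C o m n)} {φ ψ} → φ ∷ Γ ⊢ ψ → Γ ⊢ φ ⇒ ψ
  ⇒E    : ∀ {o m n} {Γ : List (Formula C o m n)} {φ ψ} → Γ ⊢ φ ⇒ ψ → Γ ⊢ φ → Γ ⊢ ψ
  ∧I    : ∀ {o m n} {Γ : List (Formula C o m n)} {φ ψ} → Γ ⊢ φ → Γ ⊢ ψ → Γ ⊢ φ ∧̇ ψ
  ∧E₁   : ∀ {o m n} {Γ : List (Formula C o m n)} {φ ψ} → Γ ⊢ φ ∧̇ ψ → Γ ⊢ φ
  ∧E₂   : ∀ {o m n} {Γ : List (Formula C o m n)} {φ ψ} → Γ ⊢ φ ∧̇ ψ → Γ ⊢ ψ
  ∨I₁   : ∀ {o m n} {Γ : List (Formula C o m n)} {φ ψ} → Γ ⊢ φ → Γ ⊢ φ ∨̇ ψ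
  ∨I₂   : ∀ {o m n} {Γ : List (Formula C o m n)} {φ ψ} → Γ ⊢ ψ → Γ ⊢ φ ∨̇ ψ
  ∨E    : ∀ {o m n} {Γ : List (Formula C o m n)} {φ ψ χ} →
          Γ ⊢ φ ∨̇ ψ → φ ∷ Γ ⊢ χ → ψ ∷ Γ ⊢ χ → Γ ⊢ χ
  ∀I    : ∀ {o m n} {Γ : List (Formula C o m n)} {φ} → map weaken Γ ⊢ φ → Γ ⊢ ∀̇ φ
  ∀E    : ∀ {o m n} {Γ : List (Formula C o m n)} {φ} (t : Term n) → Γ ⊢ ∀̇ φ → Γ ⊢ φ [ t ]
  ∃I    : ∀ {o m n} {Γ : List (Formula C o m n)} {φ} (t : Term n) → Γ ⊢ φ [ t ] → Γ ⊢ ∃̇ φ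
  ∃E    : ∀ {o m n} {Γ : List (Formula C o m n)} {φ χ} →
          Γ ⊢ ∃̇ φ → φ ∷ map weaken Γ ⊢ weaken χ → Γ ⊢ χ
  ≐-refl  : ∀ {o m n} {Γ : List (Formula C o m n)} (t : Term n) → Γ ⊢ t ≐ t
  ≐-subst : ∀ {o m n} {Γ : List (Formula C o m n)} (φ : Formula C o m (suc n)) {s t : Term n} →
            Γ ⊢ s ≐ t → Γ ⊢ φ [ s ] → Γ ⊢ φ [ t ]
  ∀²I   : ∀ {m n} {Γ : List (Formula C second m n)} {φ} → map weaken² Γ ⊢ φ → Γ ⊢ ∀² φ
  ∀²E   : ∀ {m n} {Γ : List (Formula C second m n)} {φ} (X : SetTerm C m) →
          Γ ⊢ ∀² φ → Γ ⊢ φ [ X ]²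
  ∃²I   : ∀ {m n} {Γ : List (Formula C second m n)} {φ} (X : SetTerm C m) →
          Γ ⊢ φ [ X ]² → Γ ⊢ ∃² φ
  ∃²E   : ∀ {m n} {Γ : List (Formula C second m n)} {φ χ} →
          Γ ⊢ ∃² φ → φ ∷ map weaken² Γ ⊢ weaken² χ → Γ ⊢ χ

Sentence : Set → Order → Set
Sentence C o = Formula C o 0 0

Theory : Set → Order → Set₁
Theory C o = Sentence C o → Set

_⊩_ : Theory C o → Sentence C o → Set
T ⊩ φ = ∃ λ Γ → All T Γ × (Γ ⊢ φ)

------------------------------------------------------------------------
-- BASIC, functions as sets

BASIC : List (Sentence C o)
BASIC =
    closure 1 (¬̇ (Ṡ x₀ ≐ 0̇))
  ∷ closure 2 (Ṡ x₀ ≐ Ṡ x₁ ⇒ x₀ ≐ x₁)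
  ∷ closure 1 (x₀ +̇ 0̇ ≐ x₀)
  ∷ closure 2 (x₀ +̇ Ṡ x₁ ≐ Ṡ (x₀ +̇ x₁))
  ∷ closure 1 (x₀ ·̇ 0̇ ≐ 0̇)
  ∷ closure 2 (x₀ ·̇ Ṡ x₁ ≐ x₀ ·̇ x₁ +̇ x₀)
  ∷ closure 1 (¬̇ (x₀ <̇ 0̇))
  ∷ closure 2 (x₀ <̇ Ṡ x₁ ⇔̇ x₀ <̇ x₁ ∨̇ x₀ ≐ x₁)
  ∷ closure 2 (x₀ <̇ x₁ ∨̇ x₀ ≐ x₁ ∨̇ x₁ <̇ x₀)
  ∷ closure 1 (0̇ <̇ x₀ ⇒ ∃̇ (x₀ <̇ x₁ ∧̇ Ṡ x₀ ≐ x₁))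
  ∷ closure 3 (⟨ x₀ , x₁ ⟩ ≐ x₂ ⇔̇
               2̇ ·̇ x₂ ≐ (x₀ +̇ x₁) ·̇ (x₀ +̇ x₁ +̇ 1̇) +̇ 2̇ ·̇ x₀ +̇ 2̇)
  ∷ closure 4 (⟨ x₀ , x₁ ⟩ ≐ ⟨ x₂ , x₃ ⟩ ⇒ x₀ ≐ x₂ ∧̇ x₁ ≐ x₃)
  ∷ closure 1 (0̇ <̇ x₀ ⇒ ∃̇ (x₀ <̇ x₁ ∧̇ ∃̇ (x₀ <̇ x₂ ∧̇ ⟨ x₁ , x₀ ⟩ ≐ x₂)))
  ∷ closure 2 (Ḣ ⟨ x₀ , x₁ ⟩ ≐ x₀)
  ∷ Ḣ 0̇ ≐ 0̇
  ∷ closure 2 (Ṫ ⟨ x₀ , x₁ ⟩ ≐ x₁)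
  ∷ Ṫ 0̇ ≐ 0̇
  ∷ []

_∈ℱ : SetTerm C m → Formula C o m n
f ∈ℱ = ∀̇ (∃̇ (f ⦅ x₁ ⦆≐ x₀))
     ∧̇ ∀̇ (∀̇ (∀̇ (f ⦅ x₂ ⦆≐ x₁ ∧̇ f ⦅ x₂ ⦆≐ x₀ ⇒ x₁ ≐ x₀)))
     ∧̇ ¬̇ (0̇ ∈̇ f)

-- f := X∗
oracle : (f X : SetTerm C m) → Formula C o m n
oracle f X = ∀̇ ((x₀ ∈̇ X ⇒ f ⦅ x₀ ⦆≐ 1̇) ∧̇ (¬̇ (x₀ ∈̇ X) ⇒ f ⦅ x₀ ⦆≐ 0̇))

------------------------------------------------------------------------
-- The standard model

pair : ℕ → ℕ → ℕ
pair a b = ⌊ (a + b) * (a + b + 1) + 2 * a + 2 /2⌋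

-- pair enumerates the positive numbers along the diagonals a + b = 0, 1, ….
unpair : ℕ → ℕ × ℕ
unpair zero          = 0 , 0
unpair (suc zero)    = 0 , 0
unpair (suc (suc z)) with unpair (suc z)
... | a , zero  = 0 , suc a
... | a , suc b = suc a , b

⟦_⟧ₜ : Term n → (Fin n → ℕ) → ℕ
⟦ var i ⟧ₜ     e = e i
⟦ 0̇ ⟧ₜ         e = 0
⟦ Ṡ t ⟧ₜ       e = suc (⟦ t ⟧ₜ e)
⟦ Ḣ t ⟧ₜ       e = proj₁ (unpair (⟦ t ⟧ₜ e))
⟦ Ṫ t ⟧ₜ       e = proj₂ (unpair (⟦ t ⟧ₜ e))
⟦ s +̇ t ⟧ₜ     e = ⟦ s ⟧ₜ e + ⟦ t ⟧ₜ e
⟦ s ·̇ t ⟧ₜ     e = ⟦ s ⟧ₜ e * ⟦ t ⟧ₜ e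
⟦ ⟨ s , t ⟩ ⟧ₜ e = pair (⟦ s ⟧ₜ e) (⟦ t ⟧ₜ e)

-- Classical truth, rendered by the negative translation: membership,
-- disjunction and existence carry a double negation, so that every ⟦ φ ⟧ is
-- stable and a subset of ℕ may be any predicate (not only a decidable one).
⟦_⟧ : Formula ⊥ first m n → (Fin m → ℕ → Set) → (Fin n → ℕ) → Set
⟦ s ≐ t ⟧       V e = ⟦ s ⟧ₜ e ≡ ⟦ t ⟧ₜ e
⟦ s <̇ t ⟧       V e = ⟦ s ⟧ₜ e < ⟦ t ⟧ₜ e
⟦ t ∈̇ const () ⟧ V e
⟦ t ∈̇ var i ⟧   V e = ¬ ¬ V i (⟦ t ⟧ₜ e)
⟦ ⊥̇ ⟧           V e = ⊥
⟦ φ ⇒ ψ ⟧       V e = ⟦ φ ⟧ V e → ⟦ ψ ⟧ V e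
⟦ φ ∧̇ ψ ⟧       V e = ⟦ φ ⟧ V e × ⟦ ψ ⟧ V e
⟦ φ ∨̇ ψ ⟧       V e = ¬ ¬ (⟦ φ ⟧ V e ⊎ ⟦ ψ ⟧ V e)
⟦ ∀̇ φ ⟧         V e = ∀ a → ⟦ φ ⟧ V (a ∷ᵛ e)
⟦ ∃̇ φ ⟧         V e = ¬ ¬ (∃ λ a → ⟦ φ ⟧ V (a ∷ᵛ e))

infix 4 _⊨_ _≗ˢ_

_⊨_ : (Fin m → ℕ → Set) → Formula ⊥ first m 0 → Set
V ⊨ φ = ⟦ φ ⟧ V []ᵛ

_≗ˢ_ : (A B : ℕ → Set) → Set
A ≗ˢ B = ∀ a → (¬ ¬ A a) ⇔ (¬ ¬ B a)

IsFunction : (ℕ → Set) → Set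
IsFunction A = (A ∷ᵛ []ᵛ) ⊨ X₀ ∈ℱ

------------------------------------------------------------------------
-- Function operators and classes of function algebras

-- A formula f := op(g₁,…,gₙ) given with its arity n: set variable 0 stands
-- for f and set variable j for gⱼ (1 ≤ j ≤ n).
Specification : Set
Specification = Σ ℕ λ n → Formula ⊥ first (suc n) 0

record FunctionOperator : Set₁ where
  field
    arity       : ℕ
    formula     : Formula ⊥ first (suc arity) 0
    occurs      : ∀ i → Occurs (var i) formula
    -- Unique existence, with the classical reading of "there is".
    wellDefined : (g : Fin arity → ℕ → Set) → (∀ j → IsFunction (g j)) →
                  ¬ ¬ (Σ (ℕ → Set) λ f →
                        ((f ∷ᵛ g) ⊨ formula) × IsFunction f ×
                        (∀ f′ → (f′ ∷ᵛ g) ⊨ formula → IsFunction f′ → f′ ≗ˢ f))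

  specification : Specification
  specification = arity , formula

module _ where
  private
    f : ∀ {m} → SetTerm ⊥ (1 + m)
    f = X₀
    g : ∀ {m} → SetTerm ⊥ (2 + m)
    g = X₁
    h : ∀ {m} → SetTerm ⊥ (3 + m)
    h = X₂

  S∗ ⊕ ⊗ <∗ I D P comp μ : Specification

  S∗ = 0 , closure 1 (f ⦅ x₀ ⦆≐ Ṡ x₀)

  ⊕ = 0 , closure 2 (f ⦅ ⟨ x₀ , x₁ ⟩ ⦆≐ (x₀ +̇ x₁) ∧̇ f ⦅ 0̇ ⦆≐ 0̇)

  ⊗ = 0 , closure 2 (f ⦅ ⟨ x₀ , x₁ ⟩ ⦆≐ (x₀ ·̇ x₁) ∧̇ f ⦅ 0̇ ⦆≐ 0̇)

  <∗ = 0 , closure 2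
    ( (x₀ <̇ x₁ ⇒ f ⦅ ⟨ x₀ , x₁ ⟩ ⦆≐ 1̇)
    ∧̇ (x₁ ≤̇ x₀ ⇒ f ⦅ ⟨ x₀ , x₁ ⟩ ⦆≐ 0̇)
    ∧̇ f ⦅ 0̇ ⦆≐ 0̇)

  I = 0 , closure 1 (f ⦅ x₀ ⦆≐ x₀)

  D = 0 , closure 3
    (let x = x₀; y = x₁; z = x₂ in
      f ⦅ ⟨ 0̇ , ⟨ y , z ⟩ ⟩ ⦆≐ y
    ∧̇ f ⦅ ⟨ Ṡ x , ⟨ y , z ⟩ ⟩ ⦆≐ z
    ∧̇ f ⦅ 0̇ ⦆≐ 0̇
    ∧̇ f ⦅ ⟨ x , 0̇ ⟩ ⦆≐ 0̇)

  P = 2 , closure 3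
    (let x = x₀; v = x₁; w = x₂ in
     g ⦅ x ⦆≐ v ∧̇ h ⦅ x ⦆≐ w ⇒ f ⦅ x ⦆≐ ⟨ v , w ⟩)

  comp = 2 , closure 3
    (let x = x₀; y = x₁; z = x₂ in
     h ⦅ x ⦆≐ z ∧̇ g ⦅ z ⦆≐ y ⇒ f ⦅ x ⦆≐ y)

  μ = 1 , closure 4
    (let b = x₀; x = x₁; y = x₂; z = x₃ in
      (f ⦅ ⟨ b , x ⟩ ⦆≐ z ⇒ z ≤̇ b)
    ∧̇ (f ⦅ ⟨ b , x ⟩ ⦆≐ z ∧̇ y <̇ b ∧̇ g ⦅ ⟨ y , x ⟩ ⦆≐ 1̇ ⇒ z ≤̇ y)
    ∧̇ (f ⦅ ⟨ b , x ⟩ ⦆≐ z ∧̇ z <̇ b ⇒ g ⦅ ⟨ z , x ⟩ ⦆≐ 1̇)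
    ∧̇ f ⦅ 0̇ ⦆≐ 0̇)

required : List Specification
required = S∗ ∷ ⊕ ∷ ⊗ ∷ <∗ ∷ I ∷ D ∷ P ∷ comp ∷ μ ∷ []

record FunctionAlgebraClass : Set₁ where
  field
    size     : ℕ
    operator : Fin size → FunctionOperator
    contains : All (λ s → ∃ λ i → FunctionOperator.specification (operator i) ≡ s) required

  arity : Fin size → ℕ
  arity i = FunctionOperator.arity (operator i)

  formula : (i : Fin size) → Formula ⊥ first (suc (arity i)) 0
  formula i = FunctionOperator.formula (operator i)

data Derivation (𝒜 : FunctionAlgebraClass) : Set where
  X∗ : Derivation 𝒜
  op : (i : Fin (FunctionAlgebraClass.size 𝒜)) →
       Vec (Derivation 𝒜) (FunctionAlgebraClass.arity 𝒜 i) → Derivation 𝒜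

record Enumeration (𝒜 : FunctionAlgebraClass) : Set where
  field
    bijection : ℕ ↔ Derivation 𝒜

  derivation : ℕ → Derivation 𝒜
  derivation = Inverse.to bijection

  index : Derivation 𝒜 → ℕ
  index = Inverse.from bijection

  field
    precedes : ∀ i ds j → index (lookup ds j) < index (op i ds)

------------------------------------------------------------------------
-- The theories

-- The set constants X, f₀, f₁, … of L₁(X,f⃗).
data SetConst : Set where
  X̂ : SetConst
  f̂ : ℕ → SetConst

module _ (𝒜 : FunctionAlgebraClass) (ℰ : Enumeration 𝒜) where
  open FunctionAlgebraClass 𝒜
  open Enumeration ℰ

  operands : (f : SetConst) → Vec (Derivation 𝒜) n → SetTerm ⊥ (suc n) → SetTerm SetConst 0
  operands f ds (var zero)    = const f
  operands f ds (var (suc j)) = const (f̂ (index (lookup ds j)))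

  definingFormula : (f : SetConst) → Derivation 𝒜 → Sentence SetConst first
  definingFormula f X∗        = oracle (const f) (const X̂)
  definingFormula f (op i ds) = subst² (operands f ds) (formula i)

  definingAxiom : ℕ → Sentence SetConst first
  definingAxiom d = definingFormula (f̂ d) (derivation d)

  data ARA₁ : Theory SetConst first where
    basic    : ∀ {φ} → φ ∈ˡ BASIC → ARA₁ φ
    defining : ∀ d → ARA₁ (definingAxiom d)
    function : ∀ d → ARA₁ (const (f̂ d) ∈ℱ)

  -- The conjuncts of Φₖ.
  Φ : ℕ → List (Sentence SetConst first)
  Φ zero    = []
  Φ (suc k) = definingAxiom k ∷ (const (f̂ k) ∈ℱ) ∷ Φ k

module _ (𝒜 : FunctionAlgebraClass) where
  open FunctionAlgebraClass 𝒜

  data ARA₂ : Theory ⊥ second where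
    basic         : ∀ {φ} → φ ∈ˡ BASIC → ARA₂ φ
    operation     : ∀ i → ARA₂ (closure² (arity i)
                      (⋀ (tabulate λ j → var j ∈ℱ) ⇒
                       ∃² (X₀ ∈ℱ ∧̇ embed (formula i))))
    oracleAxiom   : ARA₂ (∀² (∃² (X₀ ∈ℱ ∧̇ oracle X₀ X₁)))
    comprehension : ARA₂ (∀̇ (∀² (X₀ ∈ℱ ⇒
                      ∃² (∀̇ (x₀ ∈̇ X₀ ⇔̇ X₁ ⦅ ⟨ x₀ , x₁ ⟩ ⦆≐ 1̇)))))

------------------------------------------------------------------------
-- Lifting

-- k = d + 1 for the largest d such that f_d occurs, k = 0 if there is none.
bound : Formula SetConst first m n → ℕ
bound (s ≐ t)              = 0
bound (s <̇ t)              = 0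
bound (t ∈̇ const X̂)        = 0
bound (t ∈̇ const (f̂ d))    = suc d
bound (t ∈̇ var i)          = 0
bound ⊥̇                    = 0
bound (φ ⇒ ψ)              = bound φ ⊔ bound ψ
bound (φ ∧̇ ψ)              = bound φ ⊔ bound ψ
bound (φ ∨̇ ψ)              = bound φ ⊔ bound ψ
bound (∀̇ φ)                = bound φ
bound (∃̇ φ)                = bound φ

-- Under the prefix ∀X ∀f₀ ⋯ ∀f₍ₖ₋₁₎ the variable X has de Bruijn index k and
-- f_d has index k ∸ (1 + d).  The value at f_d for d ≥ k is immaterial:
-- asVariables k is only applied to formulas in which no such constant occurs.
position : SetConst → ℕ
position X̂     = 0
position (f̂ d) = suc d

asVariable : ∀ k → SetTerm SetConst 0 → SetTerm ⊥ (suc k)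
asVariable k (const c) = var (fromℕ< (s≤s (m∸n≤m k (position c))))

asVariables : ∀ k → Formula SetConst first 0 n → Formula ⊥ second (suc k) n
asVariables k φ = embed (subst² (asVariable k) φ)

lifted : (𝒜 : FunctionAlgebraClass) → Enumeration 𝒜 →
         Sentence SetConst first → Sentence ⊥ second
lifted 𝒜 ℰ φ = closure² (suc k) (⋀ (map (asVariables k) (Φ 𝒜 ℰ k)) ⇒ asVariables k φ)
  where
  k : ℕ
  k = bound φ

{-# OPTIONS --safe #-}
module Submission where

-- Why lifting works.  A proof of φ in ARA₁ uses finitely many axioms, hence
-- defining axioms of f₀, …, f₍K₋₁₎ only, for some K; take K at least the bound k
-- of φ, which is the number of the f_d that the lifted form of φ quantifies
-- over.  Reasoning in ARA₂, let X, f₀, …, f₍k₋₁₎ satisfy Φₖ.  The operator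
-- axioms and the oracle axiom give, one after the other, sets f_k, …, f₍K₋₁₎ for
-- which Φ_K holds (next-function): the operands of each operator come earlier in
-- the enumeration, so they are available, and are functions, when they are
-- needed.  Reading set constants as set variables turns the proof of φ in ARA₁
-- into a proof in L₂ (translate-⊢) whose hypotheses are axioms of BASIC or
-- members of Φ_K, so φ follows.  As φ does not mention f_k, …, f₍K₋₁₎, these sets
-- can be discharged by eliminating the existential set quantifiers
-- (asVariables-provable).
--
-- The contexts that arise are lists of conjunctions.  A statement Γ ⊢∧ φ says
-- that φ is a conjunct of a member of Γ; unlike Γ ⊢ φ it is visibly preserved
-- when a fresh set variable is introduced, and this makes a weakening lemma for
-- derivations superfluous.

open import Defs

open import Data.Empty using (⊥)
open import Data.Fin using (Fin; zero; suc)
open import Data.Fin.Properties using (fromℕ<-cong)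
open import Data.List using (List; []; _∷_; map; tabulate; _++_)
open import Data.List.Membership.Propositional using () renaming (_∈_ to _∈ˡ_)
open import Data.List.Membership.Propositional.Properties
  using (∈-map⁺; ∈-map⁻; ∈-++⁺ˡ; ∈-++⁺ʳ; ∈-tabulate⁺)
open import Data.List.Properties using (map-∘; map-cong; map-id)
open import Data.List.Relation.Binary.Subset.Propositional using (_⊆_)
open import Data.List.Relation.Binary.Subset.Propositional.Properties
  using (⊆-reflexive; ⊆-trans; ∷⁺ʳ; map⁺)
open import Data.List.Relation.Unary.All as All using (All; []; _∷_)
open import Data.List.Relation.Unary.All.Properties using (++⁺; tabulate⁺)
open import Data.List.Relation.Unary.Any using (here; there)
open import Data.Nat using (ℕ; zero; suc; _∸_; _≤_; _<_; _≤‴_; ≤‴-refl; ≤‴-step; _⊔_; z≤n; s≤s)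
open import Data.Nat.Properties
  using ( m∸n≤m; n∸n≡0; +-∸-assoc; m⊔n≤o⇒m≤o; m⊔n≤o⇒n≤o; m≤m⊔n; m≤n⊔m; ≤-refl; ≤-trans
        ; <⇒≤; m≤n⇒m≤1+n; m<1+n⇒m<n∨m≡n; ≤⇒≤‴)
open import Data.Product using (∃; _×_; _,_)
open import Data.Sum using (_⊎_; inj₁; inj₂)
open import Data.Vec using (lookup)
open import Function using (_∘_; id)
open import Function.Bundles using (Inverse)
open import Relation.Binary.PropositionalEquality as ≡
  using (_≡_; refl; sym; trans; cong; cong₂; module ≡-Reasoning)

private variable
  C C′ C″      : Set
  o            : Order
  m m′ m″ n n′ : ℕ

------------------------------------------------------------------------
-- Replacement of set terms

under²-weaken : (τ : SetTerm C m → SetTerm C′ m′) (X : SetTerm C m) →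
                under² τ (weakenSetTerm X) ≡ weakenSetTerm (τ X)
under²-weaken τ (const c) = refl
under²-weaken τ (var i)   = refl

under²-cong : {σ τ : SetTerm C m → SetTerm C′ m′} → (∀ X → σ X ≡ τ X) →
              ∀ X → under² σ X ≡ under² τ X
under²-cong eq (const c)     = cong weakenSetTerm (eq (const c))
under²-cong eq (var zero)    = refl
under²-cong eq (var (suc i)) = cong weakenSetTerm (eq (var i))

under²-id : {τ : SetTerm C m → SetTerm C m} → (∀ X → τ X ≡ X) → ∀ X → under² τ X ≡ X
under²-id eq (const c)     = cong weakenSetTerm (eq (const c))
under²-id eq (var zero)    = refl
under²-id eq (var (suc i)) = cong weakenSetTerm (eq (var i))

under²-∘ : (τ : SetTerm C′ m′ → SetTerm C″ m″) (σ : SetTerm C m → SetTerm C′ m′) →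
           ∀ X → under² τ (under² σ X) ≡ under² (τ ∘ σ) X
under²-∘ τ σ (const c)     = under²-weaken τ (σ (const c))
under²-∘ τ σ (var zero)    = refl
under²-∘ τ σ (var (suc i)) = under²-weaken τ (σ (var i))

subst²-cong : {σ τ : SetTerm C m → SetTerm C′ m′} → (∀ X → σ X ≡ τ X) →
              (φ : Formula C o m n) → subst² σ φ ≡ subst² τ φ
subst²-cong eq (s ≐ t)  = refl
subst²-cong eq (s <̇ t)  = refl
subst²-cong eq (t ∈̇ X)  = cong (t ∈̇_) (eq X)
subst²-cong eq ⊥̇        = refl
subst²-cong eq (φ ⇒ ψ)  = cong₂ _⇒_ (subst²-cong eq φ) (subst²-cong eq ψ)
subst²-cong eq (φ ∧̇ ψ)  = cong₂ _∧̇_ (subst²-cong eq φ) (subst²-cong eq ψ)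
subst²-cong eq (φ ∨̇ ψ)  = cong₂ _∨̇_ (subst²-cong eq φ) (subst²-cong eq ψ)
subst²-cong eq (∀̇ φ)    = cong ∀̇ (subst²-cong eq φ)
subst²-cong eq (∃̇ φ)    = cong ∃̇ (subst²-cong eq φ)
subst²-cong eq (∀² φ)   = cong ∀² (subst²-cong (under²-cong eq) φ)
subst²-cong eq (∃² φ)   = cong ∃² (subst²-cong (under²-cong eq) φ)

subst²-id : {τ : SetTerm C m → SetTerm C m} → (∀ X → τ X ≡ X) →
            (φ : Formula C o m n) → subst² τ φ ≡ φ
subst²-id eq (s ≐ t)  = refl
subst²-id eq (s <̇ t)  = refl
subst²-id eq (t ∈̇ X)  = cong (t ∈̇_) (eq X)
subst²-id eq ⊥̇        = refl
subst²-id eq (φ ⇒ ψ)  = cong₂ _⇒_ (subst²-id eq φ) (subst²-id eq ψ)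
subst²-id eq (φ ∧̇ ψ)  = cong₂ _∧̇_ (subst²-id eq φ) (subst²-id eq ψ)
subst²-id eq (φ ∨̇ ψ)  = cong₂ _∨̇_ (subst²-id eq φ) (subst²-id eq ψ)
subst²-id eq (∀̇ φ)    = cong ∀̇ (subst²-id eq φ)
subst²-id eq (∃̇ φ)    = cong ∃̇ (subst²-id eq φ)
subst²-id eq (∀² φ)   = cong ∀² (subst²-id (under²-id eq) φ)
subst²-id eq (∃² φ)   = cong ∃² (subst²-id (under²-id eq) φ)

subst²-∘ : (τ : SetTerm C′ m′ → SetTerm C″ m″) (σ : SetTerm C m → SetTerm C′ m′) →
           (φ : Formula C o m n) → subst² τ (subst² σ φ) ≡ subst² (τ ∘ σ) φ
subst²-∘ τ σ (s ≐ t)  = refl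
subst²-∘ τ σ (s <̇ t)  = refl
subst²-∘ τ σ (t ∈̇ X)  = refl
subst²-∘ τ σ ⊥̇        = refl
subst²-∘ τ σ (φ ⇒ ψ)  = cong₂ _⇒_ (subst²-∘ τ σ φ) (subst²-∘ τ σ ψ)
subst²-∘ τ σ (φ ∧̇ ψ)  = cong₂ _∧̇_ (subst²-∘ τ σ φ) (subst²-∘ τ σ ψ)
subst²-∘ τ σ (φ ∨̇ ψ)  = cong₂ _∨̇_ (subst²-∘ τ σ φ) (subst²-∘ τ σ ψ)
subst²-∘ τ σ (∀̇ φ)    = cong ∀̇ (subst²-∘ τ σ φ)
subst²-∘ τ σ (∃̇ φ)    = cong ∃̇ (subst²-∘ τ σ φ)
subst²-∘ τ σ (∀² φ)   = cong ∀²
  (trans (subst²-∘ (under² τ) (under² σ) φ) (subst²-cong (under²-∘ τ σ) φ))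
subst²-∘ τ σ (∃² φ)   = cong ∃²
  (trans (subst²-∘ (under² τ) (under² σ) φ) (subst²-cong (under²-∘ τ σ) φ))

embed-subst² : (τ : SetTerm C m → SetTerm C′ m′) (φ : Formula C first m n) →
               embed {o = o} (subst² τ φ) ≡ subst² τ (embed φ)
embed-subst² τ (s ≐ t)  = refl
embed-subst² τ (s <̇ t)  = refl
embed-subst² τ (t ∈̇ X)  = refl
embed-subst² τ ⊥̇        = refl
embed-subst² τ (φ ⇒ ψ)  = cong₂ _⇒_ (embed-subst² τ φ) (embed-subst² τ ψ)
embed-subst² τ (φ ∧̇ ψ)  = cong₂ _∧̇_ (embed-subst² τ φ) (embed-subst² τ ψ)
embed-subst² τ (φ ∨̇ ψ)  = cong₂ _∨̇_ (embed-subst² τ φ) (embed-subst² τ ψ)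
embed-subst² τ (∀̇ φ)    = cong ∀̇ (embed-subst² τ φ)
embed-subst² τ (∃̇ φ)    = cong ∃̇ (embed-subst² τ φ)

instantiate²-weaken : (Y X : SetTerm C m) → instantiate² Y (weakenSetTerm X) ≡ X
instantiate²-weaken Y (const c) = refl
instantiate²-weaken Y (var i)   = refl

-- In L₂ there are no set constants, so a closed formula contains no set terms
-- that are not bound; subst² closed regards it as a formula with m free set
-- variables.
closed : SetTerm ⊥ 0 → SetTerm ⊥ m
closed (const ())
closed (var ())

closed-unique : (σ τ : SetTerm ⊥ 0 → SetTerm ⊥ m) → ∀ X → σ X ≡ τ X
closed-unique σ τ (const ())
closed-unique σ τ (var ())

weaken²-closed : (φ : Formula ⊥ o 0 n) →
                 weaken² (subst² (closed {m}) φ) ≡ subst² closed φ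
weaken²-closed φ =
  trans (subst²-∘ weakenSetTerm closed φ) (subst²-cong (closed-unique _ _) φ)

------------------------------------------------------------------------
-- Closures

closure²-intro : ∀ m {Γ : List (Formula ⊥ second 0 n)} {φ : Formula ⊥ second m n} →
                 map (subst² closed) Γ ⊢ φ → Γ ⊢ closure² m φ
closure²-intro zero {Γ} {φ} d =
  ≡.subst (_⊢ φ) (trans (map-cong (subst²-id (closed-unique _ id)) Γ) (map-id Γ)) d
closure²-intro (suc m) {Γ} {φ} d = closure²-intro m (∀²I (≡.subst (_⊢ φ) eq d))
  where
  eq : map (subst² closed) Γ ≡ map weaken² (map (subst² closed) Γ)
  eq = trans (map-cong (λ ψ → sym (weaken²-closed ψ)) Γ) (map-∘ Γ)

closure²-elim : ∀ m {φ : Formula ⊥ second m n} {Γ : List (Formula ⊥ second m′ n)}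
                (τ : SetTerm ⊥ m → SetTerm ⊥ m′) →
                Γ ⊢ subst² closed (closure² m φ) → Γ ⊢ subst² τ φ
closure²-elim zero {φ} {Γ} τ d = ≡.subst (Γ ⊢_) (subst²-cong (closed-unique _ _) φ) d
closure²-elim (suc m) {φ} {Γ} τ d =
  ≡.subst (Γ ⊢_) eq (∀²E (τ (var zero)) (closure²-elim m {∀² φ} τ⁻ d))
  where
  τ⁻ : SetTerm ⊥ m → SetTerm ⊥ _
  τ⁻ X = τ (weakenSetTerm X)

  pointwise : ∀ X → instantiate² (τ (var zero)) (under² τ⁻ X) ≡ τ X
  pointwise (var zero)    = refl
  pointwise (var (suc i)) = instantiate²-weaken _ (τ (var (suc i)))

  eq : subst² (under² τ⁻) φ [ τ (var zero) ]² ≡ subst² τ φ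
  eq = trans (subst²-∘ _ _ φ) (subst²-cong pointwise φ)

⋀-tabulate-intro : ∀ l {Γ : List (Formula C′ o m′ n)} (τ : SetTerm C m → SetTerm C′ m′)
                   (ψ : Fin l → Formula C o m n) →
                   (∀ j → Γ ⊢ subst² τ (ψ j)) → Γ ⊢ subst² τ (⋀ (tabulate ψ))
⋀-tabulate-intro zero    τ ψ d = ⇒I (hyp (here refl))
⋀-tabulate-intro (suc l) τ ψ d = ∧I (d zero) (⋀-tabulate-intro l τ (ψ ∘ suc) (d ∘ suc))

------------------------------------------------------------------------
-- Translation of first-order derivations into L₂

-- φ under a replacement of its set terms, as a formula of the two-sorted language.
translate : (SetTerm C m → SetTerm C′ m′) → Formula C first m n → Formula C′ second m′ n
translate τ φ = embed (subst² τ φ)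

translate-subst : (τ : SetTerm C m → SetTerm C′ m′) (σ : Fin n → Term n′)
                  (φ : Formula C first m n) →
                  translate τ (subst σ φ) ≡ subst σ (translate τ φ)
translate-subst τ σ (s ≐ t)  = refl
translate-subst τ σ (s <̇ t)  = refl
translate-subst τ σ (t ∈̇ X)  = refl
translate-subst τ σ ⊥̇        = refl
translate-subst τ σ (φ ⇒ ψ)  = cong₂ _⇒_ (translate-subst τ σ φ) (translate-subst τ σ ψ)
translate-subst τ σ (φ ∧̇ ψ)  = cong₂ _∧̇_ (translate-subst τ σ φ) (translate-subst τ σ ψ)
translate-subst τ σ (φ ∨̇ ψ)  = cong₂ _∨̇_ (translate-subst τ σ φ) (translate-subst τ σ ψ)
translate-subst τ σ (∀̇ φ)    = cong ∀̇ (translate-subst τ (under σ) φ)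
translate-subst τ σ (∃̇ φ)    = cong ∃̇ (translate-subst τ (under σ) φ)

translate-weaken-⊆ : (τ : SetTerm C m → SetTerm C′ m′) {Γ : List (Formula C first m n)}
                     {Δ : List (Formula C′ second m′ n)} →
                     map (translate τ) Γ ⊆ Δ →
                     map (translate τ) (map weaken Γ) ⊆ map weaken Δ
translate-weaken-⊆ τ {Γ} sub = ⊆-trans (⊆-reflexive eq) (map⁺ weaken sub)
  where
  eq : map (translate τ) (map weaken Γ) ≡ map weaken (map (translate τ) Γ)
  eq = trans (sym (map-∘ Γ)) (trans (map-cong (translate-subst τ _) Γ) (map-∘ Γ))

translate-⊢ : (τ : SetTerm C m → SetTerm C′ m′) {Γ : List (Formula C first m n)}
              {Δ : List (Formula C′ second m′ n)} {φ : Formula C first m n} →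
              map (translate τ) Γ ⊆ Δ → Γ ⊢ φ → Δ ⊢ translate τ φ
translate-⊢ τ sub (hyp φ∈Γ)   = hyp (sub (∈-map⁺ (translate τ) φ∈Γ))
translate-⊢ τ sub (raa d)     = raa (translate-⊢ τ (∷⁺ʳ _ sub) d)
translate-⊢ τ sub (⇒I d)      = ⇒I (translate-⊢ τ (∷⁺ʳ _ sub) d)
translate-⊢ τ sub (⇒E d e)    = ⇒E (translate-⊢ τ sub d) (translate-⊢ τ sub e)
translate-⊢ τ sub (∧I d e)    = ∧I (translate-⊢ τ sub d) (translate-⊢ τ sub e)
translate-⊢ τ sub (∧E₁ d)     = ∧E₁ (translate-⊢ τ sub d)
translate-⊢ τ sub (∧E₂ d)     = ∧E₂ (translate-⊢ τ sub d)
translate-⊢ τ sub (∨I₁ d)     = ∨I₁ (translate-⊢ τ sub d)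
translate-⊢ τ sub (∨I₂ d)     = ∨I₂ (translate-⊢ τ sub d)
translate-⊢ τ sub (∨E d e f)  =
  ∨E (translate-⊢ τ sub d) (translate-⊢ τ (∷⁺ʳ _ sub) e) (translate-⊢ τ (∷⁺ʳ _ sub) f)
translate-⊢ τ sub (∀I d)      = ∀I (translate-⊢ τ (translate-weaken-⊆ τ sub) d)
translate-⊢ τ {Δ = Δ} sub (∀E {φ = φ} t d) =
  ≡.subst (Δ ⊢_) (sym (translate-subst τ (instantiate t) φ)) (∀E t (translate-⊢ τ sub d))
translate-⊢ τ {Δ = Δ} sub (∃I {φ = φ} t d) =
  ∃I t (≡.subst (Δ ⊢_) (translate-subst τ (instantiate t) φ) (translate-⊢ τ sub d))
translate-⊢ τ sub (∃E {χ = χ} d e) =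
  ∃E (translate-⊢ τ sub d)
     (≡.subst (_ ⊢_) (translate-subst τ _ χ)
       (translate-⊢ τ (∷⁺ʳ _ (translate-weaken-⊆ τ sub)) e))
translate-⊢ τ sub (≐-refl t)  = ≐-refl t
translate-⊢ τ {Δ = Δ} sub (≐-subst φ {s} {t} d e) =
  ≡.subst (Δ ⊢_) (sym (translate-subst τ (instantiate t) φ))
    (≐-subst (translate τ φ) (translate-⊢ τ sub d)
      (≡.subst (Δ ⊢_) (translate-subst τ (instantiate s) φ) (translate-⊢ τ sub e)))

-- Moving Γ into the conclusion before translating leaves an empty context, whose
-- translation is contained in any Δ.
translate-cut : (τ : SetTerm C m → SetTerm C′ m′) {Γ : List (Formula C first m n)}
                {Δ : List (Formula C′ second m′ n)} {φ : Formula C first m n} →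
                All (λ ψ → Δ ⊢ translate τ ψ) Γ → Γ ⊢ φ → Δ ⊢ translate τ φ
translate-cut τ []       d = translate-⊢ τ (λ ()) d
translate-cut τ (p ∷ ps) d = ⇒E (translate-cut τ ps (⇒I d)) p

-- BASIC contains no set terms, so it is the same list in every language.
translate-BASIC : (τ : SetTerm C 0 → SetTerm ⊥ m) {φ : Sentence C first} →
                  φ ∈ˡ BASIC → ∃ λ ψ → ψ ∈ˡ BASIC × translate τ φ ≡ subst² closed ψ
translate-BASIC τ φ∈ = ∈-map⁻ (subst² closed) {xs = BASIC} (∈-map⁺ (translate τ) φ∈)

------------------------------------------------------------------------
-- Conjuncts of hypotheses

infix 1 _⊢∧_

-- Γ ⊢∧ φ: φ is a member of Γ or obtained from one by passing to conjuncts.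
data _⊢∧_ {C : Set} {o : Order} {m n : ℕ} (Γ : List (Formula C o m n)) :
          Formula C o m n → Set where
  member : ∀ {φ} → φ ∈ˡ Γ → Γ ⊢∧ φ
  left   : ∀ {φ ψ} → Γ ⊢∧ φ ∧̇ ψ → Γ ⊢∧ φ
  right  : ∀ {φ ψ} → Γ ⊢∧ φ ∧̇ ψ → Γ ⊢∧ ψ

⊢∧⇒⊢ : {Γ : List (Formula C o m n)} {φ : Formula C o m n} → Γ ⊢∧ φ → Γ ⊢ φ
⊢∧⇒⊢ (member φ∈Γ) = hyp φ∈Γ
⊢∧⇒⊢ (left p)     = ∧E₁ (⊢∧⇒⊢ p)
⊢∧⇒⊢ (right p)    = ∧E₂ (⊢∧⇒⊢ p)

⊢∧-weaken² : {Γ : List (Formula C o m n)} {φ : Formula C o m n}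
             {χ : Formula C o (suc m) n} →
             Γ ⊢∧ φ → χ ∷ map weaken² Γ ⊢∧ weaken² φ
⊢∧-weaken² (member φ∈Γ) = member (there (∈-map⁺ weaken² φ∈Γ))
⊢∧-weaken² (left p)     = left (⊢∧-weaken² p)
⊢∧-weaken² (right p)    = right (⊢∧-weaken² p)

------------------------------------------------------------------------
-- Reading set constants as set variables

asVariable-new : ∀ k → asVariable (suc k) (const (f̂ k)) ≡ X₀
asVariable-new k = cong var (fromℕ<-cong _ 0 (n∸n≡0 k) _ (s≤s z≤n))

-- A set constant that is bound by the prefix ∀X ∀f₀ ⋯ ∀f₍k₋₁₎ is bound by the
-- same quantifier when ∀f_k is added, and its de Bruijn index is shifted.
asVariable-suc : ∀ k c → position c ≤ k →
                 asVariable (suc k) (const c) ≡ weakenSetTerm (asVariable k (const c))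
asVariable-suc k c p≤k =
  cong var (fromℕ<-cong _ (suc (k ∸ position c)) (+-∸-assoc 1 p≤k)
    _ (s≤s (s≤s (m∸n≤m k (position c)))))

-- A replacement matters only at the oracle X and at the f_d with d below the
-- bound of the formula.
subst²-bound : ∀ k {σ τ : SetTerm SetConst 0 → SetTerm C m} →
               (∀ c → position c ≤ k → σ (const c) ≡ τ (const c)) →
               (φ : Formula SetConst first 0 n) → bound φ ≤ k → subst² σ φ ≡ subst² τ φ
subst²-bound k eq (s ≐ t) b            = refl
subst²-bound k eq (s <̇ t) b            = refl
subst²-bound k eq (t ∈̇ const X̂) b      = cong (t ∈̇_) (eq X̂ z≤n)
subst²-bound k eq (t ∈̇ const (f̂ d)) b  = cong (t ∈̇_) (eq (f̂ d) b)
subst²-bound k eq ⊥̇ b                  = refl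
subst²-bound k eq (φ ⇒ ψ) b            = cong₂ _⇒_
  (subst²-bound k eq φ (m⊔n≤o⇒m≤o _ _ b)) (subst²-bound k eq ψ (m⊔n≤o⇒n≤o (bound φ) _ b))
subst²-bound k eq (φ ∧̇ ψ) b            = cong₂ _∧̇_
  (subst²-bound k eq φ (m⊔n≤o⇒m≤o _ _ b)) (subst²-bound k eq ψ (m⊔n≤o⇒n≤o (bound φ) _ b))
subst²-bound k eq (φ ∨̇ ψ) b            = cong₂ _∨̇_
  (subst²-bound k eq φ (m⊔n≤o⇒m≤o _ _ b)) (subst²-bound k eq ψ (m⊔n≤o⇒n≤o (bound φ) _ b))
subst²-bound k eq (∀̇ φ) b              = cong ∀̇ (subst²-bound k eq φ b)
subst²-bound k eq (∃̇ φ) b              = cong ∃̇ (subst²-bound k eq φ b)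

weaken²-asVariables : ∀ k (φ : Formula SetConst first 0 n) →
                      weaken² (asVariables k φ) ≡ translate (weakenSetTerm ∘ asVariable k) φ
weaken²-asVariables k φ = trans (sym (embed-subst² _ (subst² (asVariable k) φ)))
                                (cong embed (subst²-∘ _ _ φ))

weaken²-asVariables-bound : ∀ k (φ : Formula SetConst first 0 n) → bound φ ≤ k →
                            weaken² (asVariables k φ) ≡ asVariables (suc k) φ
weaken²-asVariables-bound k φ b = trans (weaken²-asVariables k φ)
  (cong embed (subst²-bound k (λ c p → sym (asVariable-suc k c p)) φ b))

------------------------------------------------------------------------
-- Construction of the functions of an algebra

module _ (𝒜 : FunctionAlgebraClass) where
  open FunctionAlgebraClass 𝒜

  -- BASIC and the axioms of ARA₂ that assert the existence of a function.
  existenceAxioms : List (Sentence ⊥ second)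
  existenceAxioms =
       BASIC
    ++ ∀² (∃² (X₀ ∈ℱ ∧̇ oracle X₀ X₁))
     ∷ tabulate (λ i → closure² (arity i)
                   (⋀ (tabulate λ j → var j ∈ℱ) ⇒ ∃² (X₀ ∈ℱ ∧̇ embed (formula i))))

  existenceAxioms-ARA₂ : All (ARA₂ 𝒜) existenceAxioms
  existenceAxioms-ARA₂ =
    ++⁺ (All.tabulate {xs = BASIC} basic) (oracleAxiom ∷ tabulate⁺ operation)

module _ (𝒜 : FunctionAlgebraClass) (ℰ : Enumeration 𝒜) where
  open FunctionAlgebraClass 𝒜
  open Enumeration ℰ

  private
    definition : (f : SetConst) → Derivation 𝒜 → Sentence SetConst first
    definition = definingFormula 𝒜 ℰ

    definitionAt : ℕ → Sentence SetConst first
    definitionAt = definingAxiom 𝒜 ℰ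

  derivation-index : ∀ {d D} → derivation d ≡ D → index D ≡ d
  derivation-index {d} refl = Inverse.strictlyInverseʳ bijection d

  operand-< : ∀ {d i ds} → derivation d ≡ op i ds → ∀ j → index (lookup ds j) < d
  operand-< {i = i} {ds} eq j =
    ≡.subst (index (lookup ds j) <_) (derivation-index eq) (precedes i ds j)

  -- The defining axiom of f_d mentions, besides f_d, only the oracle and
  -- functions enumerated earlier.
  definingAxiom-cong : ∀ d {σ τ : SetTerm SetConst 0 → SetTerm C m} →
                       (∀ c → position c ≤ suc d → σ (const c) ≡ τ (const c)) →
                       subst² σ (definitionAt d) ≡ subst² τ (definitionAt d)
  definingAxiom-cong d {σ} {τ} agree = aux (derivation d) refl
    where
    aux : ∀ D → derivation d ≡ D →
          subst² σ (definition (f̂ d) D) ≡ subst² τ (definition (f̂ d) D)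
    aux X∗ _ = cong₂ oracle (agree (f̂ d) ≤-refl) (agree X̂ z≤n)
    aux (op i ds) eq = begin
      subst² σ (subst² (operands 𝒜 ℰ (f̂ d) ds) (formula i))
        ≡⟨ subst²-∘ σ _ (formula i) ⟩
      subst² (σ ∘ operands 𝒜 ℰ (f̂ d) ds) (formula i)
        ≡⟨ subst²-cong pointwise (formula i) ⟩
      subst² (τ ∘ operands 𝒜 ℰ (f̂ d) ds) (formula i)
        ≡⟨ subst²-∘ τ _ (formula i) ⟨
      subst² τ (subst² (operands 𝒜 ℰ (f̂ d) ds) (formula i)) ∎
      where
      open ≡-Reasoning
      pointwise : ∀ X → σ (operands 𝒜 ℰ (f̂ d) ds X) ≡ τ (operands 𝒜 ℰ (f̂ d) ds X)
      pointwise (var zero)    = agree (f̂ d) ≤-refl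
      pointwise (var (suc j)) = agree (f̂ _) (s≤s (<⇒≤ (operand-< eq j)))

  weaken²-definingAxiom : ∀ {k d} → d < k →
    weaken² (asVariables k (definitionAt d)) ≡ asVariables (suc k) (definitionAt d)
  weaken²-definingAxiom {k} {d} d<k = trans (weaken²-asVariables k (definitionAt d))
    (cong embed (definingAxiom-cong d λ c p → sym (asVariable-suc k c (≤-trans p d<k))))

  -- Among the conjuncts of Γ are the axioms above and, with variables for the
  -- set constants X, f₀, …, f₍k₋₁₎, the members of Φₖ.
  record Supports (k : ℕ) (Γ : List (Formula ⊥ second (suc k) 0)) : Set where
    field
      axiom     : ∀ {ψ} → ψ ∈ˡ existenceAxioms 𝒜 → Γ ⊢∧ subst² closed ψ
      defines   : ∀ {d} → d < k → Γ ⊢∧ asVariables k (definitionAt d)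
      functions : ∀ {d} → d < k → Γ ⊢∧ asVariables k (const (f̂ d) ∈ℱ)

  next-function : ∀ {k Γ} → Supports k Γ →
                  Γ ⊢ ∃² (asVariables (suc k) (const (f̂ k) ∈ℱ) ∧̇
                          asVariables (suc k) (definitionAt k))
  next-function {k} {Γ} supports =
    ≡.subst (λ F → Γ ⊢ ∃² (F ∈ℱ ∧̇ asVariables (suc k) (definitionAt k)))
      (sym (asVariable-new k)) (aux (derivation k) refl)
    where
    open Supports supports

    aux : ∀ D → derivation k ≡ D →
          Γ ⊢ ∃² (X₀ ∈ℱ ∧̇ asVariables (suc k) (definition (f̂ k) D))
    aux X∗ _ = ≡.subst (λ ψ → Γ ⊢ ∃² (X₀ ∈ℱ ∧̇ ψ)) (cong₂ oracle
        (sym (asVariable-new k)) (sym (asVariable-suc k X̂ z≤n)))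
      (closure²-elim 1 {∃² (X₀ ∈ℱ ∧̇ oracle X₀ X₁)} (λ _ → asVariable k (const X̂))
        (⊢∧⇒⊢ (axiom (∈-++⁺ʳ BASIC (here refl)))))
    aux (op i ds) eq = ≡.subst (λ ψ → Γ ⊢ ∃² (X₀ ∈ℱ ∧̇ ψ)) same
      (⇒E (closure²-elim (arity i) τ
            (⊢∧⇒⊢ (axiom (∈-++⁺ʳ BASIC (there (∈-tabulate⁺ i))))))
          (⋀-tabulate-intro (arity i) τ (λ j → var j ∈ℱ)
            (λ j → ⊢∧⇒⊢ (functions (operand-< eq j)))))
      where
      operand : Fin (arity i) → SetConst
      operand j = f̂ (index (lookup ds j))

      τ : SetTerm ⊥ (arity i) → SetTerm ⊥ (suc k)
      τ (var j) = asVariable k (const (operand j))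

      pointwise : ∀ X → under² τ X ≡ asVariable (suc k) (operands 𝒜 ℰ (f̂ k) ds X)
      pointwise (var zero)    = sym (asVariable-new k)
      pointwise (var (suc j)) = sym (asVariable-suc k (operand j) (operand-< eq j))

      open ≡-Reasoning
      same : subst² (under² τ) (embed (formula i)) ≡
             asVariables (suc k) (definition (f̂ k) (op i ds))
      same = begin
        subst² (under² τ) (embed (formula i))
          ≡⟨ embed-subst² (under² τ) (formula i) ⟨
        embed (subst² (under² τ) (formula i))
          ≡⟨ cong embed (subst²-cong pointwise (formula i)) ⟩
        embed (subst² (asVariable (suc k) ∘ operands 𝒜 ℰ (f̂ k) ds) (formula i))
          ≡⟨ cong embed (subst²-∘ _ _ (formula i)) ⟨
        asVariables (suc k) (definition (f̂ k) (op i ds)) ∎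

  supports-next : ∀ {k Γ} → Supports k Γ →
                  Supports (suc k) ((asVariables (suc k) (const (f̂ k) ∈ℱ) ∧̇
                                     asVariables (suc k) (definitionAt k)) ∷ map weaken² Γ)
  supports-next {k} {Γ} supports = record
    { axiom     = λ {ψ} p → ≡.subst (Γ⁺ ⊢∧_) (weaken²-closed ψ) (⊢∧-weaken² (axiom p))
    ; defines   = λ d<1+k → defines⁺ (m<1+n⇒m<n∨m≡n d<1+k)
    ; functions = λ d<1+k → functions⁺ (m<1+n⇒m<n∨m≡n d<1+k)
    }
    where
    open Supports supports

    Γ⁺ : List (Formula ⊥ second (suc (suc k)) 0)
    Γ⁺ = (asVariables (suc k) (const (f̂ k) ∈ℱ) ∧̇ asVariables (suc k) (definitionAt k))
         ∷ map weaken² Γ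

    defines⁺ : ∀ {d} → d < k ⊎ d ≡ k → Γ⁺ ⊢∧ asVariables (suc k) (definitionAt d)
    defines⁺ (inj₁ d<k)  =
      ≡.subst (Γ⁺ ⊢∧_) (weaken²-definingAxiom d<k) (⊢∧-weaken² (defines d<k))
    defines⁺ (inj₂ refl) = right (member (here refl))

    functions⁺ : ∀ {d} → d < k ⊎ d ≡ k → Γ⁺ ⊢∧ asVariables (suc k) (const (f̂ d) ∈ℱ)
    functions⁺ {d} (inj₁ d<k) =
      ≡.subst (λ F → Γ⁺ ⊢∧ F ∈ℱ) (sym (asVariable-suc k (f̂ d) d<k)) (⊢∧-weaken² (functions d<k))
    functions⁺ (inj₂ refl) = left (member (here refl))

  supports-hypotheses : ∀ k →
    Supports k (⋀ (map (asVariables k) (Φ 𝒜 ℰ k)) ∷ map (subst² closed) (existenceAxioms 𝒜))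
  supports-hypotheses k = record
    { axiom     = λ p → member (there (∈-map⁺ (subst² closed) p))
    ; defines   = defines k (member (here refl))
    ; functions = functions k (member (here refl))
    }
    where
    Γ : List (Formula ⊥ second (suc k) 0)
    Γ = ⋀ (map (asVariables k) (Φ 𝒜 ℰ k)) ∷ map (subst² closed) (existenceAxioms 𝒜)

    defines : ∀ l → Γ ⊢∧ ⋀ (map (asVariables k) (Φ 𝒜 ℰ l)) →
              ∀ {d} → d < l → Γ ⊢∧ asVariables k (definitionAt d)
    defines (suc l) p d<1+l with m<1+n⇒m<n∨m≡n d<1+l
    ... | inj₁ d<l  = defines l (right (right p)) d<l
    ... | inj₂ refl = left p

    functions : ∀ l → Γ ⊢∧ ⋀ (map (asVariables k) (Φ 𝒜 ℰ l)) →
                ∀ {d} → d < l → Γ ⊢∧ asVariables k (const (f̂ d) ∈ℱ)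
    functions (suc l) p d<1+l with m<1+n⇒m<n∨m≡n d<1+l
    ... | inj₁ d<l  = functions l (right (right p)) d<l
    ... | inj₂ refl = left (right p)

------------------------------------------------------------------------
-- Lifting

  -- An axiom is a member of BASIC, or of Φₖ for every k that is at least its level.
  level : ∀ {ψ} → ARA₁ 𝒜 ℰ ψ → ℕ
  level (basic _)    = 0
  level (defining d) = suc d
  level (function d) = suc d

  levels : ∀ {Γ} → All (ARA₁ 𝒜 ℰ) Γ → ℕ
  levels []       = 0
  levels (a ∷ as) = level a ⊔ levels as

  asVariables-axiom : ∀ {k Γ ψ} → Supports k Γ → (a : ARA₁ 𝒜 ℰ ψ) → level a ≤ k →
                      Γ ⊢ asVariables k ψ
  asVariables-axiom {k} {Γ} supports (basic ψ∈) _ with translate-BASIC (asVariable k) ψ∈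
  ... | χ , χ∈ , eq = ≡.subst (Γ ⊢_) (sym eq) (⊢∧⇒⊢ (Supports.axiom supports (∈-++⁺ˡ χ∈)))
  asVariables-axiom supports (defining d) d<k = ⊢∧⇒⊢ (Supports.defines supports d<k)
  asVariables-axiom supports (function d) d<k = ⊢∧⇒⊢ (Supports.functions supports d<k)

  asVariables-axioms : ∀ {k Γ Δ} → Supports k Γ → (as : All (ARA₁ 𝒜 ℰ) Δ) → levels as ≤ k →
                       All (λ ψ → Γ ⊢ asVariables k ψ) Δ
  asVariables-axioms supports []       _ = []
  asVariables-axioms supports (a ∷ as) b =
      asVariables-axiom supports a (m⊔n≤o⇒m≤o _ _ b)
    ∷ asVariables-axioms supports as (m⊔n≤o⇒n≤o (level a) _ b)

  -- Induction on the number of functions that remain to be constructed.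
  asVariables-provable : ∀ {Δ φ} (as : All (ARA₁ 𝒜 ℰ) Δ) → Δ ⊢ φ →
                         ∀ {k K Γ} → k ≤‴ K → bound φ ≤ k → levels as ≤ K →
                         Supports k Γ → Γ ⊢ asVariables k φ
  asVariables-provable as d {k} ≤‴-refl _ l supports =
    translate-cut (asVariable k) (asVariables-axioms supports as l) d
  asVariables-provable {φ = φ} as d {k} (≤‴-step k<K) b l supports =
    ∃²E (next-function supports)
        (≡.subst (_ ⊢_) (sym (weaken²-asVariables-bound k φ b))
          (asVariables-provable as d k<K (m≤n⇒m≤1+n b) l (supports-next supports)))

theorem9p5 : (𝒜 : FunctionAlgebraClass) (ℰ : Enumeration 𝒜) (φ : Sentence SetConst first) →
    ARA₁ 𝒜 ℰ ⊩ φ → ARA₂ 𝒜 ⊩ lifted 𝒜 ℰ φ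
theorem9p5 𝒜 ℰ φ (Δ , as , d) =
    existenceAxioms 𝒜
  , existenceAxioms-ARA₂ 𝒜
  , closure²-intro (suc k)
      (⇒I (asVariables-provable 𝒜 ℰ as d {K = k ⊔ levels 𝒜 ℰ as}
            (≤⇒≤‴ (m≤m⊔n k _)) ≤-refl (m≤n⊔m k _) (supports-hypotheses 𝒜 ℰ k)))
  where
  k : ℕ
  k = bound φ
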